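{- For every positive integer $n\equiv 1\pmod{12}$ there exists an ASP$(3,n)$ with basis $[-(n-1)/2,(n-1)/2]=\{ -(n-1)/2,\dots,(n-1)/2\}$.
   Context: Let $m,n$ be positive integers and $X=\{x_1,\dots,x_n\}$ a set of $n$ distinct integers. For $j=1,\dots,m$ let $X^{(j)}=(x^{(j)}_1,\dots,x^{(j)}_n)$ be a permutation of $X$ (an ordering of its elements, viewed as a vector). The sequence $(X^{(1)},\dots,X^{(m)})$ is an additive sequence of permutations of degree $n$, denoted ASP$(m,n)$, with basis $X$, if for all $1\leq j_1\leq j_2\leq m$ the coordinatewise vector sum $X^{(j_1)}+X^{(j_1+1)}+\cdots+X^{(j_2)}$ is also a permutation of $X$. -}

module Defs where

open import Data.Nat using (ℕ; zero; suc; _≤_; _≤?_; _/_)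
open import Data.Integer using (ℤ; _+_; _-_; +_)
open import Data.Fin using (Fin; toℕ)
open import Data.Product using (Σ-syntax; _×_)
open import Data.Bool using (if_then_else_; _∧_)
open import Function.Bundles using (Bijection; _⤖_)
open import Relation.Binary.PropositionalEquality using (_≡_)
open import Relation.Nullary.Decidable using (⌊_⌋)

IVec : ℕ → Set
IVec n = Fin n → ℤ

sumFin : (m : ℕ) → (Fin m → ℤ) → ℤ
sumFin zero    f = + 0
sumFin (suc m) f = f Fin.zero + sumFin m (λ j → f (Fin.suc j))

rangeSum : {m n : ℕ} → (Fin m → IVec n) → Fin m → Fin m → IVec n
rangeSum {m} X j₁ j₂ i =
  sumFin m (λ j → if ⌊ toℕ j₁ ≤? toℕ j ⌋ ∧ ⌊ toℕ j ≤? toℕ j₂ ⌋ then X j i else + 0)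

-- The basis X = {x_1,…,x_n} is given by an enumeration x : Fin n → ℤ
-- (injective); v is a permutation of X iff v = x ∘ σ for a bijection σ of Fin n.
IsPermOf : {n : ℕ} → IVec n → IVec n → Set
IsPermOf {n} x v =
  Σ[ σ ∈ Fin n ⤖ Fin n ] (∀ i → v i ≡ x (Bijection.to σ i))

IsASP : {m n : ℕ} → IVec n → (Fin m → IVec n) → Set
IsASP {m} x X =
  (∀ j → IsPermOf x (X j)) ×
  (∀ (j₁ j₂ : Fin m) → toℕ j₁ ≤ toℕ j₂ → IsPermOf x (rangeSum X j₁ j₂))

-- Enumeration of the interval [-(n-1)/2, (n-1)/2] (for odd n): i ↦ i - (n-1)/2.
centredInterval : (n : ℕ) → IVec n
centredInterval n i = + toℕ i - + ((n Data.Nat.∸ 1) / 2)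

{-# OPTIONS --safe #-}
module Submission where

-- Write n = 12t + 1.  Read the i-th coordinates of X⁽¹⁾, X⁽²⁾, X⁽³⁾ as the successive
-- differences of four integers (a column); the six interval sums are then the six pairwise
-- differences of the column.  Take the zero column together with the orbits of 3t blocks of four
-- integers under the Klein four-group permuting the positions.  The differences of a block fall into
-- three classes of two, one for each perfect matching of the positions, and the columns form an ASP
-- as soon as, in each class, the absolute differences of the blocks cover [1, 6t].  A perfect
-- (n, 4, 1) difference family gives such blocks: rotate each of its t members about one point.
--
-- For t = 6L + c with 9 ≤ c ≤ 14 there is a perfect difference family made of six lines of L blocks,
-- whose points are affine in L and in the position u < L on the line, and of c further blocks with
-- points affine in L.  Its differences cut [1, 6t] into single values and stretches of L, 2L or 3L
-- consecutive values, swept by one, two or three interleaved differences of slope ±1, ±2 or ±3 in u.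
-- This is an identity in L, verified by computation.  The data, and those for t < 9, were found by
-- computer search.

open import Defs
import Algebra.Properties.AbelianGroup as AbelianGroup
open import Data.Bool using (T)
open import Data.Fin using (Fin; toℕ; fromℕ<; punchOut)
open import Data.Fin.Patterns using (0F; 1F; 2F; 3F; 4F; 5F; 6F; 7F; 8F)
import Data.Fin.Properties as Fin
open import Data.Integer as ℤ using (ℤ; +_; -[1+_]; +[1+_])
import Data.Integer.Properties as ℤ
open import Data.Integer.Tactic.RingSolver using (solve-∀)
open import Data.List using (List; []; _∷_; _++_; map; concatMap; length; lookup; upTo; zipWith)
open import Data.List.Membership.Propositional using (_∈_)
open import Data.List.Membership.Propositional.Properties using (∈-map⁺; ∈-upTo⁺)
import Data.List.Membership.DecPropositional as DecMembership
open import Data.List.Properties using (length-++; length-map; length-upTo)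
open import Data.List.Relation.Unary.Any as Any using (Any; here; there)
import Data.List.Relation.Unary.Any.Properties as Any
open import Data.Maybe using (Maybe; just; nothing; is-just; to-witness-T)
import Data.Maybe as Maybe
open import Data.Nat using (ℕ; zero; suc; _+_; _*_; _∸_; _/_; _%_; _≤_; _<_; _≥_; z≤n; s≤s; s≤s⁻¹; _≟_; _<?_)
open import Data.Nat.DivMod using (m≡m%n+[m/n]*n; m%n<n; m<n*o⇒m/o<n; m*n/n≡m; _divMod_; result)
import Data.Nat.Properties as ℕ
open import Data.Nat.Tactic.RingSolver using () renaming (solve-∀ to solveℕ-∀)
open import Data.Product using (Σ-syntax; ∃-syntax; _×_; _,_; proj₁; proj₂)
open import Data.Product.Properties using (≡-dec)
open import Data.Sum using (_⊎_; inj₁; inj₂)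
open import Data.Vec as Vec using (Vec; []; _∷_)
open import Function using (_∘_)
open import Function.Bundles using (mk⤖)
open import Function.Definitions using (Injective)
open import Relation.Binary.Definitions using (DecidableEquality)
open import Relation.Binary.PropositionalEquality
open import Relation.Nullary using (yes; no; contradiction)
open import Relation.Nullary.Decidable using (_⊎-dec_)

injective⇒surjective : ∀ {n} {g : Fin n → Fin n} → Injective _≡_ _≡_ g → ∀ i → ∃[ k ] g k ≡ i
injective⇒surjective {suc n} {g} inj i with Fin.any? (λ k → g k Fin.≟ i)
... | yes hit  = hit
... | no ¬hit = contradiction (Fin.injective⇒≤ punched-inj) ℕ.1+n≰n
  where
  avoids : ∀ k → i ≢ g k
  avoids k i≡gk = ¬hit (k , sym i≡gk)
  punched-inj : Injective _≡_ _≡_ (λ k → punchOut (avoids k))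
  punched-inj eq = inj (Fin.punchOut-injective (avoids _) (avoids _) eq)

covers⇒IsPermOf : ∀ {n} {x v : IVec n} → Injective _≡_ _≡_ x →
                  (∀ k → ∃[ i ] v i ≡ x k) → IsPermOf x v
covers⇒IsPermOf {n} {x} {v} x-inj cover = mk⤖ (σ-inj , σ-surj) , v≡x∘σ
  where
  g : Fin n → Fin n
  g = proj₁ ∘ cover
  g-inj : Injective _≡_ _≡_ g
  g-inj {k} {l} eq = x-inj (trans (sym (proj₂ (cover k))) (trans (cong v eq) (proj₂ (cover l))))
  σ : Fin n → Fin n
  σ i = proj₁ (injective⇒surjective g-inj i)
  g∘σ : ∀ i → g (σ i) ≡ i
  g∘σ i = proj₂ (injective⇒surjective g-inj i)
  σ-inj : Injective _≡_ _≡_ σ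
  σ-inj {i} {j} eq = trans (sym (g∘σ i)) (trans (cong g eq) (g∘σ j))
  σ-surj : ∀ k → ∃[ i ] (∀ {j} → j ≡ i → σ j ≡ k)
  σ-surj k = g k , λ { refl → g-inj (g∘σ (g k)) }
  v≡x∘σ : ∀ i → v i ≡ x (σ i)
  v≡x∘σ i = trans (cong v (sym (g∘σ i))) (proj₂ (cover (σ i)))

private
  variable
    A B : Set

orbit : Vec A 4 → List (Vec A 4)
orbit (a ∷ b ∷ c ∷ d ∷ []) =
  (a ∷ b ∷ c ∷ d ∷ []) ∷ (b ∷ a ∷ d ∷ c ∷ []) ∷
  (c ∷ d ∷ a ∷ b ∷ []) ∷ (d ∷ c ∷ b ∷ a ∷ []) ∷ []

rotate : Fin 3 → Vec A 4 → Vec A 4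
rotate 0F b                        = b
rotate 1F (a ∷ b ∷ c ∷ d ∷ []) = a ∷ c ∷ d ∷ b ∷ []
rotate 2F (a ∷ b ∷ c ∷ d ∷ []) = a ∷ d ∷ b ∷ c ∷ []

matched : (A → A → A) → Vec A 4 → List A
matched _-_ (a ∷ b ∷ c ∷ d ∷ []) = (b - a) ∷ (a - b) ∷ (d - c) ∷ (c - d) ∷ []

-- Class z consists of the signed differences along the z-th of the perfect
-- matchings {01,23}, {02,13}, {03,12} of the four points.
differences : (A → A → A) → Fin 3 → Vec A 4 → List A
differences _-_ z b = matched _-_ (rotate z b)

rotate-map : ∀ (f : A → B) z b → rotate z (Vec.map f b) ≡ Vec.map f (rotate z b)
rotate-map f 0F b                        = refl
rotate-map f 1F (a ∷ b ∷ c ∷ d ∷ []) = refl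
rotate-map f 2F (a ∷ b ∷ c ∷ d ∷ []) = refl

matched-map : ∀ {_-₁_ : A → A → A} {_-₂_ : B → B → B} (f : A → B) →
              (∀ x y → f (x -₁ y) ≡ f x -₂ f y) →
              ∀ b → map f (matched _-₁_ b) ≡ matched _-₂_ (Vec.map f b)
matched-map f hom (a ∷ b ∷ c ∷ d ∷ []) rewrite hom b a | hom a b | hom d c | hom c d = refl

differences-map : ∀ {_-₁_ : A → A → A} {_-₂_ : B → B → B} (f : A → B) →
                  (∀ x y → f (x -₁ y) ≡ f x -₂ f y) →
                  ∀ z b → map f (differences _-₁_ z b) ≡ differences _-₂_ z (Vec.map f b)
differences-map {_-₂_ = _-₂_} f hom z b =
  trans (matched-map f hom (rotate z b)) (cong (matched _-₂_) (sym (rotate-map f z b)))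

_∈Δ[_]_ : ℤ → Fin 3 → Vec ℤ 4 → Set
e ∈Δ[ z ] b = e ∈ differences ℤ._-_ z b

neg-minus : ∀ x y → ℤ.- (x ℤ.- y) ≡ y ℤ.- x
neg-minus = solve-∀

neg-matched : ∀ b {e} → e ∈ matched ℤ._-_ b → (ℤ.- e) ∈ matched ℤ._-_ b
neg-matched (a ∷ b ∷ c ∷ d ∷ []) = λ where
  (here refl)                         → there (here (neg-minus b a))
  (there (here refl))                 → here (neg-minus a b)
  (there (there (here refl)))         → there (there (there (here (neg-minus d c))))
  (there (there (there (here refl)))) → there (there (here (neg-minus c d)))

gap : Fin 4 → Fin 4 → Vec ℤ 4 → ℤ
gap p q c = Vec.lookup c q ℤ.- Vec.lookup c p

data ClassOf : Fin 4 → Fin 4 → Fin 3 → Set where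
  class01 : ClassOf 0F 1F 0F
  class23 : ClassOf 2F 3F 0F
  class02 : ClassOf 0F 2F 1F
  class13 : ClassOf 1F 3F 1F
  class03 : ClassOf 0F 3F 2F
  class12 : ClassOf 1F 2F 2F

orbit-gap : ∀ {p q z} → ClassOf p q z → ∀ b {e} → e ∈Δ[ z ] b → Any (λ c → gap p q c ≡ e) (orbit b)
orbit-gap class01 (_ ∷ _ ∷ _ ∷ _ ∷ []) = λ where
  (here e)                         → here (sym e)
  (there (here e))                 → there (here (sym e))
  (there (there (here e)))         → there (there (here (sym e)))
  (there (there (there (here e)))) → there (there (there (here (sym e))))
orbit-gap class23 (_ ∷ _ ∷ _ ∷ _ ∷ []) = λ where
  (here e)                         → there (there (here (sym e)))
  (there (here e))                 → there (there (there (here (sym e))))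
  (there (there (here e)))         → here (sym e)
  (there (there (there (here e)))) → there (here (sym e))
orbit-gap class02 (_ ∷ _ ∷ _ ∷ _ ∷ []) = λ where
  (here e)                         → here (sym e)
  (there (here e))                 → there (there (here (sym e)))
  (there (there (here e)))         → there (there (there (here (sym e))))
  (there (there (there (here e)))) → there (here (sym e))
orbit-gap class13 (_ ∷ _ ∷ _ ∷ _ ∷ []) = λ where
  (here e)                         → there (here (sym e))
  (there (here e))                 → there (there (there (here (sym e))))
  (there (there (here e)))         → there (there (here (sym e)))
  (there (there (there (here e)))) → here (sym e)
orbit-gap class03 (_ ∷ _ ∷ _ ∷ _ ∷ []) = λ where
  (here e)                         → here (sym e)
  (there (here e))                 → there (there (there (here (sym e))))
  (there (there (here e)))         → there (here (sym e))
  (there (there (there (here e)))) → there (there (here (sym e)))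
orbit-gap class12 (_ ∷ _ ∷ _ ∷ _ ∷ []) = λ where
  (here e)                         → there (here (sym e))
  (there (here e))                 → there (there (here (sym e)))
  (there (there (here e)))         → here (sym e)
  (there (there (there (here e)))) → there (there (there (here (sym e))))

Covers : ℕ → List (Vec ℤ 4) → Set
Covers h bs = ∀ z {d} → 1 ≤ d → d ≤ h → Any ((+ d) ∈Δ[ z ]_) bs

columns : List (Vec ℤ 4) → List (Vec ℤ 4)
columns bs = Vec.replicate 4 (+ 0) ∷ concatMap orbit bs

length-orbits : (bs : List (Vec ℤ 4)) → length (concatMap orbit bs) ≡ length bs * 4
length-orbits []                             = refl
length-orbits ((_ ∷ _ ∷ _ ∷ _ ∷ []) ∷ bs) = cong (λ k → 4 + k) (length-orbits bs)

columns-gap : ∀ {h bs p q z} → ClassOf p q z → Covers h bs →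
              ∀ e → ℤ.∣ e ∣ ≤ h → Any (λ c → gap p q c ≡ e) (columns bs)
columns-gap cl cov (+ zero) _ = here (zero-gap cl)
  where
  zero-gap : ∀ {p q z} → ClassOf p q z → gap p q (Vec.replicate 4 (+ 0)) ≡ + 0
  zero-gap class01 = refl
  zero-gap class23 = refl
  zero-gap class02 = refl
  zero-gap class13 = refl
  zero-gap class03 = refl
  zero-gap class12 = refl
columns-gap cl cov +[1+ d ] d<h =
  there (Any.concatMap⁺ orbit (Any.map (λ {b} → orbit-gap cl b) (cov _ (s≤s z≤n) d<h)))
columns-gap {z = z} cl cov -[1+ d ] d<h =
  there (Any.concatMap⁺ orbit (Any.map (λ {b} → orbit-gap cl b ∘ neg-matched (rotate z b)) (cov _ (s≤s z≤n) d<h)))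

∣m-h∣≤h : ∀ {m} h → m ≤ h + h → ℤ.∣ + m ℤ.- + h ∣ ≤ h
∣m-h∣≤h {m} h m≤2h rewrite ℤ.m-n≡m⊖n m h with ℕ.≤-total h m
... | inj₁ h≤m rewrite ℤ.⊖-≥ h≤m =
  subst (m ∸ h ≤_) (ℕ.m+n∸n≡m h h) (ℕ.∸-monoˡ-≤ h m≤2h)
... | inj₂ m≤h rewrite ℤ.∣⊖∣-≤ m≤h = ℕ.m∸n≤m h m

centredInterval-injective : ∀ n → Injective _≡_ _≡_ (centredInterval n)
centredInterval-injective n {i} {j} eq =
  Fin.toℕ-injective (ℤ.+-injective
    (AbelianGroup.∙-cancelʳ ℤ.+-0-abelianGroup (ℤ.- + ((n ∸ 1) / 2)) (+ toℕ i) (+ toℕ j) eq))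

module FromBlocks (bs : List (Vec ℤ 4)) (h : ℕ) (4∣bs∣≡2h : length bs * 4 ≡ h * 2) (cov : Covers h bs) where

  n : ℕ
  n = length (columns bs)

  column : Fin n → Vec ℤ 4
  column = lookup (columns bs)

  n≡1+2h : n ≡ suc (h * 2)
  n≡1+2h = cong suc (trans (length-orbits bs) 4∣bs∣≡2h)

  half : (n ∸ 1) / 2 ≡ h
  half = trans (cong (λ k → (k ∸ 1) / 2) n≡1+2h) (m*n/n≡m h 2)

  gap-IsPermOf : ∀ {p q z} → ClassOf p q z → IsPermOf (centredInterval n) (gap p q ∘ column)
  gap-IsPermOf {p} {q} cl = covers⇒IsPermOf (centredInterval-injective n) hit
    where
    hit : ∀ k → ∃[ i ] gap p q (column i) ≡ centredInterval n k
    hit k = Any.index any , Any.lookup-index any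
      where
      k≤2h : toℕ k ≤ h + h
      k≤2h = subst (toℕ k ≤_) (trans (ℕ.*-comm h 2) (cong (λ k → h + k) (ℕ.+-identityʳ h)))
                   (s≤s⁻¹ (subst (toℕ k <_) n≡1+2h (Fin.toℕ<n k)))
      any : Any (λ c → gap p q c ≡ centredInterval n k) (columns bs)
      any = columns-gap cl cov _
              (subst (λ m → ℤ.∣ + toℕ k ℤ.- + m ∣ ≤ h) (sym half) (∣m-h∣≤h h k≤2h))

  IsPermOf-≗ : ∀ {v w : IVec n} → (∀ i → w i ≡ v i) →
               IsPermOf (centredInterval n) v → IsPermOf (centredInterval n) w
  IsPermOf-≗ w≗v (σ , eq) = σ , λ i → trans (w≗v i) (eq i)

  X : Fin 3 → IVec n
  X 0F = gap 0F 1F ∘ column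
  X 1F = gap 1F 2F ∘ column
  X 2F = gap 2F 3F ∘ column

  sum₀₀ : ∀ x → x ℤ.+ + 0 ≡ x
  sum₀₀ = solve-∀
  sum₀₁ : ∀ a b c → (b ℤ.- a) ℤ.+ ((c ℤ.- b) ℤ.+ + 0) ≡ c ℤ.- a
  sum₀₁ = solve-∀
  sum₀₂ : ∀ a b c d → (b ℤ.- a) ℤ.+ ((c ℤ.- b) ℤ.+ ((d ℤ.- c) ℤ.+ + 0)) ≡ d ℤ.- a
  sum₀₂ = solve-∀
  sum₁₁ : ∀ x → + 0 ℤ.+ (x ℤ.+ + 0) ≡ x
  sum₁₁ = solve-∀
  sum₁₂ : ∀ b c d → + 0 ℤ.+ ((c ℤ.- b) ℤ.+ ((d ℤ.- c) ℤ.+ + 0)) ≡ d ℤ.- b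
  sum₁₂ = solve-∀
  sum₂₂ : ∀ x → + 0 ℤ.+ (+ 0 ℤ.+ (x ℤ.+ + 0)) ≡ x
  sum₂₂ = solve-∀

  X-isASP : IsASP (centredInterval n) X
  X-isASP = (λ { 0F → gap-IsPermOf class01 ; 1F → gap-IsPermOf class12 ; 2F → gap-IsPermOf class23 }) , sums
    where
    at : Fin 4 → Fin n → ℤ
    at p i = Vec.lookup (column i) p
    sums : ∀ j₁ j₂ → toℕ j₁ ≤ toℕ j₂ → IsPermOf (centredInterval n) (rangeSum X j₁ j₂)
    sums 0F 0F _ = IsPermOf-≗ (λ i → sum₀₀ (X 0F i)) (gap-IsPermOf class01)
    sums 0F 1F _ = IsPermOf-≗ (λ i → sum₀₁ (at 0F i) (at 1F i) (at 2F i)) (gap-IsPermOf class02)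
    sums 0F 2F _ = IsPermOf-≗ (λ i → sum₀₂ (at 0F i) (at 1F i) (at 2F i) (at 3F i)) (gap-IsPermOf class03)
    sums 1F 1F _ = IsPermOf-≗ (λ i → sum₁₁ (X 1F i)) (gap-IsPermOf class12)
    sums 1F 2F _ = IsPermOf-≗ (λ i → sum₁₂ (at 1F i) (at 2F i) (at 3F i)) (gap-IsPermOf class13)
    sums 2F 2F _ = IsPermOf-≗ (λ i → sum₂₂ (X 2F i)) (gap-IsPermOf class23)
    sums 1F 0F ()
    sums 2F 0F ()
    sums 2F 1F (s≤s ())

-- (α , β , γ) stands for αL + βu + γ.
Lin : Set
Lin = ℤ × ℤ × ℤ

_⊖_ : Lin → Lin → Lin
(α , β , γ) ⊖ (α′ , β′ , γ′) = α ℤ.- α′ , β ℤ.- β′ , γ ℤ.- γ′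

⟦_⟧ : Lin → ℕ → ℕ → ℤ
⟦ α , β , γ ⟧ L u = α ℤ.* + L ℤ.+ β ℤ.* + u ℤ.+ γ

⟦⟧-⊖ : ∀ L u x y → ⟦ x ⊖ y ⟧ L u ≡ ⟦ x ⟧ L u ℤ.- ⟦ y ⟧ L u
⟦⟧-⊖ L u (α , β , γ) (α′ , β′ , γ′) = ring (+ L) (+ u) α β γ α′ β′ γ′
  where
  ring : ∀ L u α β γ α′ β′ γ′ →
         (α ℤ.- α′) ℤ.* L ℤ.+ (β ℤ.- β′) ℤ.* u ℤ.+ (γ ℤ.- γ′) ≡
         (α ℤ.* L ℤ.+ β ℤ.* u ℤ.+ γ) ℤ.- (α′ ℤ.* L ℤ.+ β′ ℤ.* u ℤ.+ γ′)
  ring = solve-∀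

_≟ᴸ_ : DecidableEquality Lin
_≟ᴸ_ = ≡-dec ℤ._≟_ (≡-dec ℤ._≟_ ℤ._≟_)

open DecMembership _≟ᴸ_ using (_∈?_)

_∈Λ[_]_ : Lin → Fin 3 → Vec Lin 4 → Set
e ∈Λ[ z ] b = e ∈ differences _⊖_ z b

instantiate : ℕ → ℕ → Vec Lin 4 → Vec ℤ 4
instantiate L u = Vec.map (λ e → ⟦ e ⟧ L u)

instantiate-∈ : ∀ L u z b {e} → e ∈Λ[ z ] b → ⟦ e ⟧ L u ∈Δ[ z ] instantiate L u b
instantiate-∈ L u z b {e} e∈ =
  subst (⟦ e ⟧ L u ∈_) (differences-map (λ x → ⟦ x ⟧ L u) (⟦⟧-⊖ L u) z b) (∈-map⁺ _ e∈)

record Family : Set where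
  field
    pieces    : List (Vec Lin 4)
    sporadics : List (Vec Lin 4)

  piece-blocks : ℕ → Vec Lin 4 → List (Vec ℤ 4)
  piece-blocks L p = map (λ u → instantiate L u p) (upTo L)

  blocks : ℕ → List (Vec ℤ 4)
  blocks L = concatMap (piece-blocks L) pieces ++ map (instantiate L 0) sporadics

  length-blocks : ∀ L → length (blocks L) ≡ length pieces * L + length sporadics
  length-blocks L = trans (length-++ (concatMap (piece-blocks L) pieces))
    (cong₂ _+_ (go pieces) (length-map (instantiate L 0) sporadics))
    where
    go : ∀ ps → length (concatMap (piece-blocks L) ps) ≡ length ps * L
    go []       = refl
    go (p ∷ ps) = trans (length-++ (piece-blocks L p))
      (cong₂ _+_ (trans (length-map _ (upTo L)) (length-upTo L)) (go ps))

  module _ (z : Fin 3) where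

    -- As u runs through 0, …, L - 1, some difference of p in class z runs up or down through kL + c + mu.
    Sweeps : ℕ → ℕ → ℕ → Vec Lin 4 → Set
    Sweeps k c m p = ((+ k , + m , + c) ∈Λ[ z ] p) ⊎ ((+ (m + k) , ℤ.- + m , + c ℤ.- + m) ∈Λ[ z ] p)

    -- Tiling K C k c covers the integers from kL + c up to KL + C (exclusive).
    data Tiling (K C : ℕ) : ℕ → ℕ → Set where
      end   : Tiling K C K C
      point : ∀ {k c} → Any ((+ k , + 0 , + c) ∈Λ[ z ]_) sporadics →
              Tiling K C k (suc c) → Tiling K C k c
      run   : ∀ {k c} m → (∀ (r : Fin (suc m)) → Any (Sweeps k (toℕ r + c) (suc m)) pieces) →
              Tiling K C (suc m + k) c → Tiling K C k c

    tiling? : ℕ → ∀ K C k c → Maybe (Tiling K C k c)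
    tiling? zero K C k c = nothing
    tiling? (suc fuel) K C k c with k ≟ K | c ≟ C
    ... | yes refl | yes refl = just end
    ... | _ | _ with Any.any? (λ b → (+ k , + 0 , + c) ∈? differences _⊖_ z b) sporadics
    ...   | yes hit = Maybe.map (point hit) (tiling? fuel K C k (suc c))
    ...   | no _    = try 0 Maybe.<∣> try 1 Maybe.<∣> try 2
      where
      try : ℕ → Maybe (Tiling K C k c)
      try m with Fin.all? (λ (r : Fin (suc m)) → Any.any? (λ p →
                   ((+ k , + suc m , + (toℕ r + c)) ∈? differences _⊖_ z p) ⊎-dec
                   ((+ (suc m + k) , ℤ.- + suc m , + (toℕ r + c) ℤ.- + suc m) ∈? differences _⊖_ z p)) pieces)
      ... | yes sweeps = Maybe.map (run m sweeps) (tiling? fuel K C (suc m + k) c)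
      ... | no _       = nothing

    module _ (L : ℕ) where

      Hit : ℕ → Set
      Hit d = Any ((+ d) ∈Δ[ z ]_) (blocks L)

      point-hit : ∀ {k c} → Any ((+ k , + 0 , + c) ∈Λ[ z ]_) sporadics → Hit (k * L + c)
      point-hit {k} {c} any = Any.++⁺ʳ (concatMap (piece-blocks L) pieces) (Any.map⁺ (Any.map step any))
        where
        value : ⟦ + k , + 0 , + c ⟧ L 0 ≡ + (k * L + c)
        value = cong (ℤ._+ + c) (trans (ℤ.+-identityʳ _) (sym (ℤ.pos-* k L)))
        step : ∀ {b} → (+ k , + 0 , + c) ∈Λ[ z ] b → (+ (k * L + c)) ∈Δ[ z ] instantiate L 0 b
        step {b} e∈ = subst (_∈Δ[ z ] instantiate L 0 b) value (instantiate-∈ L 0 z b e∈)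

      sweep-hit : ∀ {k c m u} → u < L → Any (Sweeps k c m) pieces → Hit (k * L + (u * m + c))
      sweep-hit {k} {c} {m} {u} u<L any = Any.++⁺ˡ (Any.concatMap⁺ (piece-blocks L) (Any.map step any))
        where
        v : ℕ
        v = L ∸ suc u
        L≡ : L ≡ suc (u + v)
        L≡ = sym (ℕ.m+[n∸m]≡n u<L)
        v<L : v < L
        v<L = subst (v <_) (sym L≡) (s≤s (ℕ.m≤n+m v u))
        target : + (k * L + (u * m + c)) ≡ + k ℤ.* + L ℤ.+ (+ u ℤ.* + m ℤ.+ + c)
        target = cong₂ ℤ._+_ (ℤ.pos-* k L) (cong (ℤ._+ + c) (ℤ.pos-* u m))
        up : ∀ k L m u c → k ℤ.* L ℤ.+ (u ℤ.* m ℤ.+ c) ≡ k ℤ.* L ℤ.+ m ℤ.* u ℤ.+ c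
        up = solve-∀
        down : ∀ k m u c v → k ℤ.* (+ 1 ℤ.+ (u ℤ.+ v)) ℤ.+ (u ℤ.* m ℤ.+ c) ≡
               (m ℤ.+ k) ℤ.* (+ 1 ℤ.+ (u ℤ.+ v)) ℤ.+ ℤ.- m ℤ.* v ℤ.+ (c ℤ.- m)
        down = solve-∀
        down-value : + (k * L + (u * m + c)) ≡ ⟦ + (m + k) , ℤ.- + m , + c ℤ.- + m ⟧ L v
        down-value = trans target (subst
          (λ l → + k ℤ.* l ℤ.+ (+ u ℤ.* + m ℤ.+ + c) ≡ (+ m ℤ.+ + k) ℤ.* l ℤ.+ ℤ.- + m ℤ.* + v ℤ.+ (+ c ℤ.- + m))
          (cong +_ (sym L≡)) (down (+ k) (+ m) (+ u) (+ c) (+ v)))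
        at : ∀ {p e} w → w < L → e ∈Λ[ z ] p → + (k * L + (u * m + c)) ≡ ⟦ e ⟧ L w →
             Any ((+ (k * L + (u * m + c))) ∈Δ[ z ]_) (piece-blocks L p)
        at {p} w w<L e∈ eq = Any.map⁺ (Any.map
          (λ { refl → subst (_∈Δ[ z ] instantiate L w p) (sym eq) (instantiate-∈ L w z p e∈) }) (∈-upTo⁺ w<L))
        step : ∀ {p} → Sweeps k c m p → Any ((+ (k * L + (u * m + c))) ∈Δ[ z ]_) (piece-blocks L p)
        step (inj₁ e∈) = at u u<L e∈ (trans target (up (+ k) (+ L) (+ m) (+ u) (+ c)))
        step (inj₂ e∈) = at v v<L e∈ down-value

      tiling⇒hit : ∀ {K C k c} → Tiling K C k c → ∀ {d} → k * L + c ≤ d → d < K * L + C → Hit d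
      tiling⇒hit end lo hi = contradiction (ℕ.≤-<-trans lo hi) (ℕ.<-irrefl refl)
      tiling⇒hit (point {k} {c} hit rest) {d} lo hi with ℕ.m≤n⇒m<n∨m≡n lo
      ... | inj₁ lo′  = tiling⇒hit rest (subst (_≤ d) (sym (ℕ.+-suc (k * L) c)) lo′) hi
      ... | inj₂ refl = point-hit hit
      tiling⇒hit (run {k} {c} m sweeps rest) {d} lo hi with (d ∸ (k * L + c)) <? L * suc m
      ... | yes v<mL = subst Hit value
              (sweep-hit (m<n*o⇒m/o<n v<mL) (subst (λ r → Any (Sweeps k (r + c) (suc m)) pieces)
                (Fin.toℕ-fromℕ< (m%n<n v (suc m))) (sweeps (fromℕ< (m%n<n v (suc m))))))
        where
        v : ℕ
        v = d ∸ (k * L + c)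
        rearrange : ∀ x y r c → x + (y + (r + c)) ≡ x + c + (r + y)
        rearrange = solveℕ-∀
        value : k * L + (v / suc m * suc m + (v % suc m + c)) ≡ d
        value = trans (rearrange (k * L) (v / suc m * suc m) (v % suc m) c)
          (trans (cong (λ w → k * L + c + w) (sym (m≡m%n+[m/n]*n v (suc m)))) (ℕ.m+[n∸m]≡n lo))
      ... | no v≮mL = tiling⇒hit rest (subst (_≤ d) (rearrange k L c m)
              (subst (k * L + c + L * suc m ≤_) (ℕ.m+[n∸m]≡n lo) (ℕ.+-monoʳ-≤ (k * L + c) (ℕ.≮⇒≥ v≮mL)))) hi
        where
        rearrange : ∀ k L c m → k * L + c + L * suc m ≡ (suc m + k) * L + c
        rearrange = solveℕ-∀

  covers : ∀ K C → (∀ z → Tiling z K (suc C) 0 1) → ∀ L → Covers (K * L + C) (blocks L)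
  covers K C tiles L z {d} 1≤d d≤h =
    tiling⇒hit z L (tiles z) 1≤d (subst (suc d ≤_) (sym (ℕ.+-suc (K * L) C)) (s≤s d≤h))

HasASP : ℕ → Set
HasASP n = Σ[ X ∈ (Fin 3 → IVec n) ] IsASP (centredInterval n) X

covers⇒HasASP : ∀ bs h → length bs * 4 ≡ h * 2 → Covers h bs → HasASP (suc (h * 2))
covers⇒HasASP bs h 4∣bs∣≡2h cov = subst HasASP n≡1+2h (X , X-isASP)
  where open FromBlocks bs h 4∣bs∣≡2h cov

rotations : Vec A 4 → List (Vec A 4)
rotations b = rotate 0F b ∷ rotate 1F b ∷ rotate 2F b ∷ []

rotations-any : ∀ {P : Vec A 4 → Set} z b → Any P (rotations b) → Any (P ∘ rotate z) (rotations b)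
rotations-any 0F (_ ∷ _ ∷ _ ∷ _ ∷ []) = λ any → any
rotations-any 1F (_ ∷ _ ∷ _ ∷ _ ∷ []) = λ where
  (here p)                 → there (there (here p))
  (there (here p))         → here p
  (there (there (here p))) → there (here p)
rotations-any 2F (_ ∷ _ ∷ _ ∷ _ ∷ []) = λ where
  (here p)                 → there (here p)
  (there (here p))         → there (there (here p))
  (there (there (here p))) → here p

rotated : List (Vec Lin 4) → List (Vec Lin 4) → Family
rotated ps ss = record { pieces = concatMap rotations ps ; sporadics = concatMap rotations ss }

rotated-any : ∀ {P : Vec Lin 4 → Set} bs z →
              Any P (concatMap rotations bs) → Any (P ∘ rotate z) (concatMap rotations bs)
rotated-any bs z any =
  Any.concatMap⁺ rotations (Any.map (λ {b} → rotations-any z b) (Any.concatMap⁻ rotations {xs = bs} any))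

module _ (ps ss : List (Vec Lin 4)) where
  open Family (rotated ps ss)

  -- Rotating the blocks permutes the classes, so it is enough to tile one class.
  rotated-tiling : ∀ {K C k c} → Tiling 0F K C k c → ∀ z → Tiling z K C k c
  rotated-tiling end                z = end
  rotated-tiling (point hit rest)   z = point (rotated-any ss z hit) (rotated-tiling rest z)
  rotated-tiling (run m sweeps rest) z = run m (rotated-any ps z ∘ sweeps) (rotated-tiling rest z)

ruler : ℕ × ℕ × ℕ → Vec Lin 4
ruler (x , y , w) = Vec.map (λ a → + 0 , + 0 , + a) (0 ∷ x ∷ y ∷ w ∷ [])

-- Perfect difference families, except for t = 2, 3, where none exists.
small : Fin 9 → List (Vec Lin 4)
small 0F = []
small 1F = concatMap rotations (map ruler ((1 , 4 , 6) ∷ []))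
small 2F = map ruler
  ((12 , 6 , 10) ∷ (9 , 11 , 4) ∷ (3 , 12 , 11) ∷ (10 , 9 , 3) ∷ (5 , 10 , 8) ∷ (11 , 4 , 12) ∷ [])
small 3F = map ruler
  ((18 , 11 , 16) ∷ (14 , 17 , 8) ∷ (3 , 18 , 17) ∷ (16 , 15 , 4) ∷ (12 , 3 , 11) ∷
   (15 , 13 , 6) ∷ (4 , 16 , 14) ∷ (17 , 7 , 13) ∷ (13 , 8 , 18) ∷ [])
small 4F = concatMap rotations (map ruler
  ((2 , 10 , 24) ∷ (1 , 18 , 21) ∷ (4 , 13 , 19) ∷ (7 , 12 , 23) ∷ []))
small 5F = concatMap rotations (map ruler
  ((1 , 10 , 30) ∷ (4 , 21 , 27) ∷ (2 , 16 , 28) ∷ (5 , 13 , 24) ∷ (3 , 18 , 25) ∷ []))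
small 6F = concatMap rotations (map ruler
  ((1 , 9 , 36) ∷ (5 , 23 , 34) ∷ (3 , 17 , 33) ∷ (2 , 24 , 28) ∷ (6 , 21 , 31) ∷ (12 , 19 , 32) ∷ []))
small 7F = concatMap rotations (map ruler
  ((1 , 6 , 42) ∷ (3 , 26 , 34) ∷ (11 , 25 , 38) ∷ (4 , 24 , 33) ∷ (7 , 22 , 39) ∷ (2 , 21 , 37) ∷
   (10 , 28 , 40) ∷ []))
small 8F = concatMap rotations (map ruler
  ((1 , 3 , 48) ∷ (8 , 33 , 43) ∷ (4 , 27 , 40) ∷ (5 , 26 , 42) ∷ (9 , 28 , 39) ∷ (7 , 29 , 41) ∷
   (14 , 31 , 46) ∷ (6 , 24 , 44) ∷ []))

small-family : Fin 9 → Family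
small-family t = record { pieces = [] ; sporadics = small t }

small-HasASP : ∀ t → HasASP (suc (toℕ t * 6 * 2))
small-HasASP t = covers⇒HasASP (blocks 0) (toℕ t * 6) (size t)
  (covers 0 (toℕ t * 6) (λ z → to-witness-T (tiling? z 50 0 (suc (toℕ t * 6)) 0 1) (tiles t z)) 0)
  where
  open Family (small-family t)
  size : ∀ t → length (Family.blocks (small-family t) 0) * 4 ≡ toℕ t * 6 * 2
  size 0F = refl
  size 1F = refl
  size 2F = refl
  size 3F = refl
  size 4F = refl
  size 5F = refl
  size 6F = refl
  size 7F = refl
  size 8F = refl
  tiles : ∀ t z → T (is-just (Family.tiling? (small-family t) z 50 0 (suc (toℕ t * 6)) 0 1))
  tiles 0F = λ { 0F → _ ; 1F → _ ; 2F → _ }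
  tiles 1F = λ { 0F → _ ; 1F → _ ; 2F → _ }
  tiles 2F = λ { 0F → _ ; 1F → _ ; 2F → _ }
  tiles 3F = λ { 0F → _ ; 1F → _ ; 2F → _ }
  tiles 4F = λ { 0F → _ ; 1F → _ ; 2F → _ }
  tiles 5F = λ { 0F → _ ; 1F → _ ; 2F → _ }
  tiles 6F = λ { 0F → _ ; 1F → _ ; 2F → _ }
  tiles 7F = λ { 0F → _ ; 1F → _ ; 2F → _ }
  tiles 8F = λ { 0F → _ ; 1F → _ ; 2F → _ }

-- Each point is given by its coefficients of L and u.
lines : List (Vec (ℕ × ℕ) 4)
lines =
  ((0 , 0) ∷ (0 , 3) ∷ (25 , 1) ∷ (30 , 2) ∷ []) ∷
  ((0 , 0) ∷ (0 , 3) ∷ (21 , 1) ∷ (34 , 2) ∷ []) ∷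
  ((0 , 0) ∷ (15 , 3) ∷ (28 , 1) ∷ (34 , 2) ∷ []) ∷
  ((0 , 0) ∷ (0 , 3) ∷ (9 , 2) ∷ (32 , 1) ∷ []) ∷
  ((0 , 0) ∷ (11 , 2) ∷ (15 , 3) ∷ (26 , 1) ∷ []) ∷
  ((0 , 1) ∷ (4 , 0) ∷ (19 , 3) ∷ (27 , 2) ∷ []) ∷ []

line : Vec (ℕ × ℕ) 4 → Vec ℕ 3 → Vec Lin 4
line slopes offsets = Vec.zipWith (λ (α , β) γ → + α , + β , + γ) slopes (0 ∷ offsets)

offsets : Fin 6 → List (Vec ℕ 3)
offsets 0F =
  (3 ∷ 38 ∷ 46 ∷ []) ∷ (5 ∷ 33 ∷ 54 ∷ []) ∷ (25 ∷ 43 ∷ 53 ∷ []) ∷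
  (4 ∷ 16 ∷ 49 ∷ []) ∷ (19 ∷ 27 ∷ 40 ∷ []) ∷ (5 ∷ 31 ∷ 41 ∷ []) ∷ []
offsets 1F =
  (3 ∷ 44 ∷ 54 ∷ []) ∷ (5 ∷ 38 ∷ 62 ∷ []) ∷ (30 ∷ 50 ∷ 61 ∷ []) ∷
  (4 ∷ 19 ∷ 57 ∷ []) ∷ (23 ∷ 31 ∷ 47 ∷ []) ∷ (5 ∷ 34 ∷ 47 ∷ []) ∷ []
offsets 2F =
  (3 ∷ 47 ∷ 56 ∷ []) ∷ (5 ∷ 40 ∷ 65 ∷ []) ∷ (31 ∷ 52 ∷ 64 ∷ []) ∷
  (4 ∷ 19 ∷ 59 ∷ []) ∷ (22 ∷ 30 ∷ 48 ∷ []) ∷ (6 ∷ 38 ∷ 51 ∷ []) ∷ []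
offsets 3F =
  (4 ∷ 48 ∷ 59 ∷ []) ∷ (5 ∷ 42 ∷ 67 ∷ []) ∷ (32 ∷ 53 ∷ 66 ∷ []) ∷
  (3 ∷ 20 ∷ 61 ∷ []) ∷ (24 ∷ 34 ∷ 51 ∷ []) ∷ (5 ∷ 38 ∷ 52 ∷ []) ∷ []
offsets 4F =
  (6 ∷ 56 ∷ 70 ∷ []) ∷ (5 ∷ 47 ∷ 77 ∷ []) ∷ (36 ∷ 61 ∷ 76 ∷ []) ∷
  (4 ∷ 24 ∷ 71 ∷ []) ∷ (28 ∷ 38 ∷ 59 ∷ []) ∷ (6 ∷ 43 ∷ 59 ∷ []) ∷ []
offsets 5F =
  (4 ∷ 61 ∷ 76 ∷ []) ∷ (6 ∷ 55 ∷ 86 ∷ []) ∷ (41 ∷ 69 ∷ 85 ∷ []) ∷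
  (5 ∷ 26 ∷ 80 ∷ []) ∷ (31 ∷ 43 ∷ 66 ∷ []) ∷ (8 ∷ 50 ∷ 68 ∷ []) ∷ []

-- Each point is given by its coefficient of L and its constant term.
lone : (ℕ × ℕ) × (ℕ × ℕ) × (ℕ × ℕ) → Vec Lin 4
lone (x , y , w) = Vec.map (λ (α , γ) → + α , + 0 , + γ) ((0 , 0) ∷ x ∷ y ∷ w ∷ [])

lones : Fin 6 → List ((ℕ × ℕ) × (ℕ × ℕ) × (ℕ × ℕ))
lones 0F =
  ((4 , 7) , (13 , 20) , (34 , 52)) ∷ ((0 , 1) , (28 , 42) , (34 , 51)) ∷ ((3 , 4) , (21 , 30) , (30 , 44)) ∷
  ((11 , 17) , (19 , 29) , (32 , 48)) ∷ ((3 , 5) , (18 , 28) , (26 , 39)) ∷ ((3 , 3) , (26 , 38) , (32 , 46)) ∷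
  ((11 , 18) , (22 , 33) , (36 , 54)) ∷ ((15 , 22) , (15 , 24) , (33 , 49)) ∷ ((4 , 6) , (11 , 16) , (36 , 53)) ∷ []
lones 1F =
  ((0 , 2) , (21 , 36) , (32 , 56)) ∷ ((5 , 8) , (13 , 22) , (28 , 47)) ∷ ((4 , 7) , (15 , 28) , (34 , 60)) ∷
  ((4 , 6) , (13 , 23) , (34 , 58)) ∷ ((6 , 10) , (21 , 37) , (28 , 48)) ∷ ((5 , 9) , (19 , 33) , (28 , 49)) ∷
  ((8 , 15) , (11 , 18) , (34 , 59)) ∷ ((7 , 12) , (18 , 31) , (33 , 57)) ∷ ((0 , 1) , (18 , 30) , (25 , 43)) ∷
  ((3 , 4) , (29 , 50) , (32 , 55)) ∷ []
lones 2F =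
  ((0 , 1) , (18 , 31) , (27 , 49)) ∷ ((3 , 3) , (26 , 47) , (32 , 56)) ∷ ((0 , 2) , (15 , 29) , (34 , 63)) ∷
  ((8 , 14) , (13 , 22) , (36 , 65)) ∷ ((3 , 4) , (22 , 40) , (33 , 59)) ∷ ((6 , 10) , (13 , 23) , (36 , 64)) ∷
  ((9 , 16) , (18 , 33) , (32 , 58)) ∷ ((7 , 12) , (21 , 38) , (34 , 62)) ∷ ((3 , 6) , (11 , 21) , (36 , 66)) ∷
  ((3 , 5) , (21 , 37) , (32 , 57)) ∷ ((4 , 7) , (19 , 35) , (25 , 46)) ∷ []
lones 3F =
  ((0 , 1) , (15 , 31) , (36 , 72)) ∷ ((0 , 2) , (30 , 58) , (36 , 70)) ∷ ((8 , 16) , (11 , 19) , (34 , 64)) ∷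
  ((4 , 9) , (27 , 51) , (36 , 69)) ∷ ((6 , 11) , (21 , 39) , (34 , 63)) ∷ ((4 , 7) , (23 , 43) , (36 , 66)) ∷
  ((8 , 15) , (23 , 44) , (34 , 65)) ∷ ((3 , 4) , (29 , 53) , (33 , 61)) ∷ ((14 , 25) , (19 , 35) , (33 , 62)) ∷
  ((8 , 17) , (11 , 22) , (29 , 55)) ∷ ((7 , 13) , (25 , 47) , (36 , 67)) ∷ ((4 , 6) , (18 , 32) , (25 , 46)) ∷ []
lones 4F =
  ((0 , 1) , (0 , 3) , (30 , 68)) ∷ ((9 , 22) , (13 , 29) , (32 , 70)) ∷ ((9 , 21) , (23 , 51) , (34 , 75)) ∷
  ((5 , 10) , (23 , 50) , (34 , 73)) ∷ ((6 , 14) , (19 , 42) , (34 , 74)) ∷ ((13 , 27) , (18 , 39) , (36 , 76)) ∷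
  ((4 , 9) , (25 , 55) , (30 , 66)) ∷ ((3 , 4) , (8 , 17) , (29 , 62)) ∷ ((7 , 15) , (15 , 35) , (33 , 71)) ∷
  ((7 , 16) , (28 , 59) , (36 , 77)) ∷ ((11 , 26) , (15 , 34) , (36 , 78)) ∷ ((3 , 5) , (18 , 38) , (32 , 69)) ∷
  ((8 , 19) , (11 , 25) , (33 , 72)) ∷ []
lones 5F =
  ((0 , 1) , (0 , 3) , (21 , 54)) ∷ ((3 , 4) , (18 , 44) , (32 , 76)) ∷ ((4 , 11) , (19 , 49) , (32 , 79)) ∷
  ((5 , 12) , (26 , 62) , (34 , 81)) ∷ ((8 , 20) , (11 , 25) , (26 , 61)) ∷ ((5 , 14) , (19 , 45) , (34 , 84)) ∷
  ((3 , 8) , (11 , 29) , (30 , 75)) ∷ ((7 , 17) , (25 , 59) , (34 , 83)) ∷ ((3 , 6) , (14 , 34) , (32 , 77)) ∷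
  ((6 , 15) , (21 , 52) , (32 , 78)) ∷ ((4 , 10) , (9 , 23) , (23 , 58)) ∷ ((9 , 22) , (23 , 55) , (34 , 82)) ∷
  ((4 , 9) , (23 , 56) , (30 , 74)) ∷ ((3 , 7) , (26 , 64) , (33 , 80)) ∷ []

large : Fin 6 → Family
large r = rotated (zipWith line lines (offsets r)) (map lone (lones r))

large-HasASP : ∀ r L → HasASP (suc ((36 * L + (9 + toℕ r) * 6) * 2))
large-HasASP r L = covers⇒HasASP (blocks L) _ size
  (covers 36 ((9 + toℕ r) * 6)
    (rotated-tiling (zipWith line lines (offsets r)) (map lone (lones r))
      (to-witness-T (tiling? 0F 120 36 (suc ((9 + toℕ r) * 6)) 0 1) (tiles r))) L)
  where
  open Family (large r)
  double : ∀ L c → (18 * L + c * 3) * 4 ≡ (36 * L + c * 6) * 2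
  double = solveℕ-∀
  counts : ∀ r → length (Family.pieces (large r)) * L + length (Family.sporadics (large r)) ≡ 18 * L + (9 + toℕ r) * 3
  counts 0F = refl
  counts 1F = refl
  counts 2F = refl
  counts 3F = refl
  counts 4F = refl
  counts 5F = refl
  size : length (blocks L) * 4 ≡ (36 * L + (9 + toℕ r) * 6) * 2
  size = trans (cong (_* 4) (trans (length-blocks L) (counts r))) (double L (9 + toℕ r))
  tiles : ∀ r → T (is-just (Family.tiling? (large r) 0F 120 36 (suc ((9 + toℕ r) * 6)) 0 1))
  tiles 0F = _
  tiles 1F = _
  tiles 2F = _
  tiles 3F = _
  tiles 4F = _
  tiles 5F = _

all-HasASP : ∀ t → HasASP (suc (t * 12))
all-HasASP t with t <? 9
... | yes t<9 = subst HasASP (cong suc eq) (small-HasASP (fromℕ< t<9))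
  where
  eq : toℕ (fromℕ< t<9) * 6 * 2 ≡ t * 12
  eq = trans (cong (λ k → k * 6 * 2) (Fin.toℕ-fromℕ< t<9)) (ℕ.*-assoc t 6 2)
... | no t≮9 with (t ∸ 9) divMod 6
...   | result L r t-9≡ = subst HasASP (cong suc eq) (large-HasASP r L)
  where
  rearrange : ∀ L r → (36 * L + (9 + r) * 6) * 2 ≡ (9 + (r + L * 6)) * 12
  rearrange = solveℕ-∀
  t≡ : 9 + (toℕ r + L * 6) ≡ t
  t≡ = trans (cong (λ s → 9 + s) (sym t-9≡)) (ℕ.m+[n∸m]≡n (ℕ.≮⇒≥ t≮9))
  eq : (36 * L + (9 + toℕ r) * 6) * 2 ≡ t * 12
  eq = trans (rearrange L (toℕ r)) (cong (_* 12) {9 + (toℕ r + L * 6)} {t} t≡)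

theorem6p4 : (n : ℕ) → n ≥ 1 → n % 12 ≡ 1 →
    Σ[ X ∈ (Fin 3 → IVec n) ] IsASP (centredInterval n) X
theorem6p4 n _ n%12≡1 = subst HasASP (sym n≡) (all-HasASP (n / 12))
  where
  n≡ : n ≡ suc (n / 12 * 12)
  n≡ = trans (m≡m%n+[m/n]*n n 12) (cong (λ r → r + n / 12 * 12) n%12≡1)
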